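{- Let $G=(V,E)$ be a connected digraph, and let $u$ be a vertex in $G$. If $u$ does not have an edge to a vertex $v\neq u$ (that is, $uv\notin E$), then there is an out-neighbor $x$ of $u$ such that $\mathbb{P}(L(x,v)) \le \mathbb{P}(L(u,v))$. Furthermore, this inequality is strict (for some such out-neighbor $x$) if there is a directed walk from $u$ to $v$ which visits all vertices in $G$, but does not revisit $u$.
   Context: Digraphs are finite and simple: there are no loops and at most one edge from $a$ to $b$ for each ordered pair of distinct vertices $(a,b)$; both $ab$ and $ba$ may be edges, where $ab$ denotes the edge directed from $a$ to $b$. Connected means strongly connected (there is a directed walk from every vertex to every other vertex). An out-neighbor of $u$ is a vertex $x$ with $ux\in E$. A cover tour of $G$ from a vertex $u$ is a directed walk which begins at $u$ and ends when it has visited every vertex of $G$. A random cover tour from $u$ is the random walk that starts at $u$ (which counts as visited), moves at each step with equal probability to any out-neighbor of its current vertex, and ends when it has visited every vertex. $L(u,v)$ denotes the event that $v$ is the last vertex to be visited by a random cover tour beginning at $u$. A walk starting at $u$ does not revisit $u$ if $u$ occurs in it only as its first vertex.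
   Formalization: In the strict part the walk from u to v is required to contain v only as its last vertex; if v may be passed earlier the claim fails, e.g. for edges ua, av, vu, vb, bv and the walk u a v b v, where P(L(u,v)) = 0. -}

module Defs where

open import Data.Bool.Base using (Bool; true; false; T; if_then_else_)
open import Data.Bool.Properties using (T?)
import Data.Bool.Properties as Bool
open import Data.Fin.Base using (Fin)
open import Data.Fin.Properties using (_≟_; all?)
open import Data.Integer.Base as ℤ using (ℤ; -[1+_])
import Data.Integer.Properties as ℤ
open import Data.List.Base using (List; []; _∷_; [_]; _∷ʳ_; _++_; length; map; filter; allFin; takeWhile; drop; cartesianProduct)
open import Data.List.Membership.Propositional using (_∈_; _∉_)
open import Data.List.Membership.Propositional.Properties using (∈-filter⁺; ∈-allFin; ∈-map⁺; ∈-++⁺ˡ; ∈-++⁺ʳ; ∈-cartesianProduct⁺)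
open import Data.List.Relation.Unary.Any using (here; there)
open import Data.List.Relation.Unary.Linked using (Linked)
open import Data.Nat.Base as ℕ using (ℕ; zero; suc)
import Data.Nat.Properties as ℕ
open import Data.Product.Base using (∃; _×_; _,_; proj₁; proj₂; map₂)
open import Data.Rational.Base using (ℚ; mkℚ; 0ℚ; 1ℚ; _+_; _*_; _-_; -_; _≤_; _<_; _⊔_; ∣_∣; 1/_; _/_; toℚᵘ; positive; nonNegative)
open import Data.Rational.Properties hiding (_≟_)
open import Data.Rational.Solver using (module +-*-Solver)
import Data.Rational.Unnormalised.Base as ℚᵘ
import Data.Rational.Unnormalised.Properties as ℚᵘ
open import Data.Sum.Base using (_⊎_; inj₁; inj₂)
open import Data.Vec.Base using (Vec; []; _∷_; lookup; replicate; _[_]≔_)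
open import Data.Vec.Properties using (lookup∘updateAt; lookup∘updateAt′; lookup-replicate)
open import Function.Base using (_∘_)
open import Relation.Binary.Construct.Closure.ReflexiveTransitive as Star using (Star; _◅_)
open import Relation.Binary.PropositionalEquality using (_≡_; _≢_; refl; sym; trans; cong; cong₂; subst)
open import Relation.Nullary using (Dec; yes; no; does; ¬_; contradiction)
open import Relation.Nullary.Decidable using (map′; ¬?; _×-dec_; _→-dec_; dec-true; dec-false)
import Data.List.Membership.DecPropositional as DecMembership

Σ : {A : Set} → List A → (A → ℚ) → ℚ
Σ []       f = 0ℚ
Σ (x ∷ xs) f = f x + Σ xs f

-- The first argument is the value on the empty list.
average : {A : Set} → ℚ → List A → (A → ℚ) → ℚ
average d []       f = d
average d (x ∷ xs) f = (ℤ.+ 1 / length (x ∷ xs)) * Σ (x ∷ xs) f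

TendsTo : (ℕ → ℚ) → ℚ → Set
TendsTo a p = ∀ ε → 0ℚ < ε → ∃ λ N → ∀ k → N ℕ.≤ k → ∣ a k - p ∣ < ε

𝟙 : {P : Set} → Dec P → ℚ
𝟙 P? = if does P? then 1ℚ else 0ℚ

record Digraph : Set where
  field
    order    : ℕ
    adj      : Fin order → Fin order → Bool
    loopless : ∀ a → adj a a ≡ false

  Vertex : Set
  Vertex = Fin order

  Edge : Vertex → Vertex → Set
  Edge a b = T (adj a b)

  outNeighbors : Vertex → List Vertex
  outNeighbors a = filter (T? ∘ adj a) (allFin order)

module _ (G : Digraph) where
  open Digraph G
  open DecMembership (_≟_ {order}) using (_∈?_)

  Connected : Set
  Connected = ∀ a b → Star Edge a b

  -- A walk is the list of its successive vertices. It goes from u to v in the sense that it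
  -- stops on reaching v: v occurs only as its last vertex. (If v could be passed on the way, the
  -- strict inequality would fail for the digraph u → a → v → u, v ⇄ b and the walk u a v b v,
  -- as v is then never the last vertex to be visited from u.)
  WalkFromTo : Vertex → Vertex → List Vertex → Set
  WalkFromTo u v w = Linked Edge w × ∃ λ p → w ≡ u ∷ p ∷ʳ v × v ∉ u ∷ p

  VisitsAll : List Vertex → Set
  VisitsAll w = ∀ z → z ∈ w

  NoRevisit : Vertex → List Vertex → Set
  NoRevisit u w = u ∉ drop 1 w

  -- Expectation of f over the vertex lists of the first k steps of the random walk from u.
  -- A walk at a vertex without out-neighbors stops there; in a connected digraph this concerns
  -- only the one-vertex digraph.
  𝔼 : ℕ → Vertex → (List Vertex → ℚ) → ℚ
  𝔼 zero    u f = f [ u ]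
  𝔼 (suc k) u f = average (f [ u ]) (outNeighbors u) (λ y → 𝔼 k y (f ∘ (u ∷_)))

  before : Vertex → List Vertex → List Vertex
  before v = takeWhile (λ z → ¬? (z ≟ v))

  -- The walk w has visited every vertex, and v after all the others; steps made after the
  -- cover tour has ended do not matter.
  LastVisited : Vertex → List Vertex → Set
  LastVisited v w = v ∈ w × (∀ z → z ≢ v → z ∈ before v w)

  lastVisited? : ∀ v w → Dec (LastVisited v w)
  lastVisited? v w = (v ∈? w) ×-dec all? (λ z → ¬? (z ≟ v) →-dec (z ∈? before v w))

  -- Probability that the random cover tour from u ends within k steps and its last vertex is v.
  ℙLWithin : ℕ → Vertex → Vertex → ℚ
  ℙLWithin k u v = 𝔼 k u (λ w → 𝟙 (lastVisited? v w))

-- The events of ℙLWithin increase with k to L(u,v), so ℙ(L(u,v)) is the limit. The rest of this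
-- file shows that in a connected digraph the limit exists in ℚ, being the solution of a linear
-- system; ℙL and its characterisation ℙL-limit are at the end.

open ≤-Reasoning
open +-*-Solver using (solve; _:=_; _:+_; _:*_; _:-_; :-_; con)

*-monoˡ : ∀ {p q} r → 0ℚ ≤ r → p ≤ q → r * p ≤ r * q
*-monoˡ r 0≤r = *-monoˡ-≤-nonNeg r {{nonNegative 0≤r}}

*-monoʳ : ∀ {p q} r → 0ℚ ≤ r → p ≤ q → p * r ≤ q * r
*-monoʳ r 0≤r = *-monoʳ-≤-nonNeg r {{nonNegative 0≤r}}

*-nonNeg : ∀ {p q} → 0ℚ ≤ p → 0ℚ ≤ q → 0ℚ ≤ p * q
*-nonNeg {p} {q} 0≤p 0≤q = begin
  0ℚ      ≡⟨ sym (*-zeroʳ p) ⟩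
  p * 0ℚ  ≤⟨ *-monoˡ p 0≤p 0≤q ⟩
  p * q   ∎

+-nonNeg : ∀ {p q} → 0ℚ ≤ p → 0ℚ ≤ q → 0ℚ ≤ p + q
+-nonNeg = +-mono-≤

*-pos : ∀ {p q} → 0ℚ < p → 0ℚ < q → 0ℚ < p * q
*-pos {p} {q} 0<p 0<q = begin-strict
  0ℚ      ≡⟨ sym (*-zeroʳ p) ⟩
  p * 0ℚ  <⟨ *-monoʳ-<-pos p {{positive 0<p}} 0<q ⟩
  p * q   ∎

p≤p+q : ∀ {p q} → 0ℚ ≤ q → p ≤ p + q
p≤p+q {p} {q} 0≤q = begin
  p       ≡⟨ sym (+-identityʳ p) ⟩
  p + 0ℚ  ≤⟨ +-monoʳ-≤ p 0≤q ⟩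
  p + q   ∎

p≤q+p : ∀ {p q} → 0ℚ ≤ q → p ≤ q + p
p≤q+p {p} {q} 0≤q = ≤-trans (p≤p+q 0≤q) (≤-reflexive (+-comm p q))

inverse : ∀ {p} → 0ℚ < p → ∃ λ r → 0ℚ < r × r * p ≡ 1ℚ
inverse {p} 0<p =
  (1/ p) {{nz}} , positive⁻¹ ((1/ p) {{nz}}) {{1/pos⇒pos p {{pos}}}} , *-inverseˡ p {{nz}}
  where
  pos = positive 0<p
  nz = pos⇒nonZero p {{pos}}

<⇒0<- : ∀ {p q} → p < q → 0ℚ < q - p
<⇒0<- {p} {q} p<q = begin-strict
  0ℚ     ≡⟨ sym (+-inverseʳ p) ⟩
  p - p  <⟨ +-monoˡ-< (- p) p<q ⟩
  q - p  ∎

nat : ℕ → ℚ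
nat zero    = 0ℚ
nat (suc k) = 1ℚ + nat k

0≤nat : ∀ k → 0ℚ ≤ nat k
0≤nat zero    = ≤-refl
0≤nat (suc k) = +-nonNeg (nonNegative⁻¹ 1ℚ) (0≤nat k)

nat-mono : ∀ {j k} → j ℕ.≤ k → nat j ≤ nat k
nat-mono {k = k} ℕ.z≤n = 0≤nat k
nat-mono (ℕ.s≤s j≤k) = +-monoʳ-≤ 1ℚ (nat-mono j≤k)

toℚᵘ-nat : ∀ k → toℚᵘ (nat k) ℚᵘ.≃ ℚᵘ.mkℚᵘ (ℤ.+ k) 0
toℚᵘ-nat zero    = ℚᵘ.*≡* refl
toℚᵘ-nat (suc k) = ℚᵘ.≃-trans (toℚᵘ-homo-+ 1ℚ (nat k))
  (ℚᵘ.≃-trans (ℚᵘ.+-congʳ (toℚᵘ 1ℚ) (toℚᵘ-nat k))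
    (ℚᵘ.*≡* (cong (λ i → (ℤ.+ 1 ℤ.+ i) ℤ.* ℤ.+ 1) (ℤ.*-identityʳ (ℤ.+ k)))))

archimedean : ∀ p → ∃ λ N → p ≤ nat N
archimedean p@(mkℚ n d _) = ℤ.∣ n ∣ , toℚᵘ-cancel-≤
  (ℚᵘ.≤-respʳ-≃ (ℚᵘ.≃-sym (toℚᵘ-nat ℤ.∣ n ∣)) (ℚᵘ.*≤* (le n)))
  where
  le : ∀ n → n ℤ.* ℤ.+ 1 ℤ.≤ ℤ.+ ℤ.∣ n ∣ ℤ.* ℤ.+ suc d
  le (ℤ.+ m) = ℤ.*-monoˡ-≤-nonNeg (ℤ.+ m) (ℤ.+≤+ (ℕ.s≤s ℕ.z≤n))
  le -[1+ m ] = ℤ.-≤+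

1/n*n : ∀ m → (ℤ.+ 1 / suc m) * nat (suc m) ≡ 1ℚ
1/n*n m = toℚᵘ-injective (ℚᵘ.≃-trans (toℚᵘ-homo-* (ℤ.+ 1 / suc m) (nat (suc m)))
  (ℚᵘ.≃-trans (ℚᵘ.*-cong (toℚᵘ-fromℚᵘ (ℚᵘ.mkℚᵘ (ℤ.+ 1) m)) (toℚᵘ-nat (suc m)))
    (ℚᵘ.*≡* (cong ℤ.+_ (trans (ℕ.*-identityʳ _) (sym (trans (ℕ.*-identityˡ _) (cong suc (trans (ℕ.*-identityʳ m) (sym (ℕ.+-identityʳ m))))))))) ))

0<1/n : ∀ m → 0ℚ < (ℤ.+ 1 / suc m)
0<1/n m = toℚᵘ-cancel-< (ℚᵘ.<-respʳ-≃ (ℚᵘ.≃-sym (toℚᵘ-fromℚᵘ (ℚᵘ.mkℚᵘ (ℤ.+ 1) m)))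
  (ℚᵘ.*<* (ℤ.+<+ (ℕ.s≤s ℕ.z≤n))))

pow : ℚ → ℕ → ℚ
pow ρ zero    = 1ℚ
pow ρ (suc k) = ρ * pow ρ k

pow-nonNeg : ∀ {ρ} → 0ℚ ≤ ρ → ∀ k → 0ℚ ≤ pow ρ k
pow-nonNeg 0≤ρ zero    = nonNegative⁻¹ 1ℚ
pow-nonNeg 0≤ρ (suc k) = *-nonNeg 0≤ρ (pow-nonNeg 0≤ρ k)

bernoulli : ∀ {d} → 0ℚ ≤ d → 0ℚ ≤ 1ℚ - d → ∀ k → pow (1ℚ - d) k * (1ℚ + nat k * d) ≤ 1ℚ
bernoulli {d} 0≤d 0≤ρ zero = ≤-reflexive (solve 1 (λ d → con 1ℚ :* (con 1ℚ :+ con 0ℚ :* d) := con 1ℚ) refl d)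
bernoulli {d} 0≤d 0≤ρ (suc k) = begin
  ((1ℚ - d) * P) * (1ℚ + (1ℚ + N) * d)
    ≤⟨ p≤p+q (*-nonNeg (pow-nonNeg 0≤ρ k) (*-nonNeg 0≤d (+-nonNeg (*-nonNeg (0≤nat k) 0≤d) 0≤d))) ⟩
  ((1ℚ - d) * P) * (1ℚ + (1ℚ + N) * d) + P * (d * (N * d + d))
    ≡⟨ solve 3 (λ d P N → ((con 1ℚ :- d) :* P) :* (con 1ℚ :+ (con 1ℚ :+ N) :* d) :+ P :* (d :* (N :* d :+ d))
         := P :* (con 1ℚ :+ N :* d)) refl d P N ⟩
  P * (1ℚ + N * d)
    ≤⟨ bernoulli 0≤d 0≤ρ k ⟩
  1ℚ ∎
  where
  P = pow (1ℚ - d) k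
  N = nat k

geometric : ∀ {ρ} C ε → 0ℚ ≤ ρ → ρ < 1ℚ → 0ℚ < ε → ∃ λ N → ∀ k → N ℕ.≤ k → pow ρ k * C < ε
geometric {ρ} C ε 0≤ρ ρ<1 0<ε = N , bound
  where
  mid = <-dense 0<ε
  δ = proj₁ mid
  0<δ = proj₁ (proj₂ mid)
  d = 1ℚ - ρ
  0<d = <⇒0<- ρ<1
  ρ≡ : 1ℚ - d ≡ ρ
  ρ≡ = solve 1 (λ ρ → con 1ℚ :- (con 1ℚ :- ρ) := ρ) refl ρ
  0<x = *-pos 0<d 0<δ
  inv = inverse 0<x
  r = proj₁ inv
  arch = archimedean (C * r)
  N = proj₁ arch
  bound : ∀ k → N ℕ.≤ k → pow ρ k * C < ε
  bound k N≤k = begin-strict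
    pow ρ k * C
      ≡⟨ cong (pow ρ k *_) (trans (sym (*-identityʳ C)) (trans (cong (C *_) (sym (proj₂ (proj₂ inv)))) (sym (*-assoc C r _)))) ⟩
    pow ρ k * (C * r * (d * δ))
      ≤⟨ *-monoˡ _ (pow-nonNeg 0≤ρ k) (*-monoʳ _ (<⇒≤ 0<x) (≤-trans (proj₂ arch) (nat-mono N≤k))) ⟩
    pow ρ k * (nat k * (d * δ))
      ≤⟨ p≤p+q (*-nonNeg (pow-nonNeg 0≤ρ k) (<⇒≤ 0<δ)) ⟩
    pow ρ k * (nat k * (d * δ)) + pow ρ k * δ
      ≡⟨ solve 4 (λ P n d δ → P :* (n :* (d :* δ)) :+ P :* δ := (P :* (con 1ℚ :+ n :* d)) :* δ) refl (pow ρ k) (nat k) d δ ⟩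
    (pow ρ k * (1ℚ + nat k * d)) * δ
      ≡⟨ cong (λ σ → (pow σ k * (1ℚ + nat k * d)) * δ) (sym ρ≡) ⟩
    (pow (1ℚ - d) k * (1ℚ + nat k * d)) * δ
      ≤⟨ *-monoʳ δ (<⇒≤ 0<δ) (bernoulli (<⇒≤ 0<d) (subst (0ℚ ≤_) (sym ρ≡) 0≤ρ) k) ⟩
    1ℚ * δ  ≡⟨ *-identityˡ δ ⟩
    δ       <⟨ proj₂ (proj₂ mid) ⟩
    ε       ∎

module _ {A : Set} where

  Σ-cong : ∀ (xs : List A) {f g} → (∀ x → f x ≡ g x) → Σ xs f ≡ Σ xs g
  Σ-cong []       eq = refl
  Σ-cong (x ∷ xs) eq = cong₂ _+_ (eq x) (Σ-cong xs eq)

  Σ-mono : ∀ (xs : List A) {f g} → (∀ x → f x ≤ g x) → Σ xs f ≤ Σ xs g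
  Σ-mono []       le = ≤-refl
  Σ-mono (x ∷ xs) le = +-mono-≤ (le x) (Σ-mono xs le)

  Σ-mono-< : ∀ (xs : List A) {f g z} → (∀ x → f x ≤ g x) → z ∈ xs → f z < g z → Σ xs f < Σ xs g
  Σ-mono-< (x ∷ xs) le (here refl) lt = +-mono-<-≤ lt (Σ-mono xs le)
  Σ-mono-< (x ∷ xs) le (there z∈)  lt = +-mono-≤-< (le x) (Σ-mono-< xs le z∈ lt)

  Σ-0 : ∀ (xs : List A) → Σ xs (λ _ → 0ℚ) ≡ 0ℚ
  Σ-0 []       = refl
  Σ-0 (x ∷ xs) = trans (+-identityˡ _) (Σ-0 xs)

  Σ-nonNeg : ∀ (xs : List A) {f} → (∀ x → 0ℚ ≤ f x) → 0ℚ ≤ Σ xs f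
  Σ-nonNeg xs nn = ≤-trans (≤-reflexive (sym (Σ-0 xs))) (Σ-mono xs nn)

  Σ-+ : ∀ (xs : List A) f g → Σ xs (λ x → f x + g x) ≡ Σ xs f + Σ xs g
  Σ-+ []       f g = refl
  Σ-+ (x ∷ xs) f g = trans (cong ((f x + g x) +_) (Σ-+ xs f g))
    (solve 4 (λ a b c d → a :+ b :+ (c :+ d) := a :+ c :+ (b :+ d)) refl (f x) (g x) (Σ xs f) (Σ xs g))

  Σ-*ˡ : ∀ (xs : List A) c f → Σ xs (λ x → c * f x) ≡ c * Σ xs f
  Σ-*ˡ []       c f = sym (*-zeroʳ c)
  Σ-*ˡ (x ∷ xs) c f = trans (cong (c * f x +_) (Σ-*ˡ xs c f)) (sym (*-distribˡ-+ c (f x) (Σ xs f)))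

  Σ-const : ∀ (xs : List A) c → Σ xs (λ _ → c) ≡ nat (length xs) * c
  Σ-const []       c = sym (*-zeroˡ c)
  Σ-const (x ∷ xs) c = trans (cong (c +_) (Σ-const xs c))
    (solve 2 (λ c n → c :+ n :* c := (con 1ℚ :+ n) :* c) refl c (nat (length xs)))

  ∣Σ∣ : ∀ (xs : List A) f → ∣ Σ xs f ∣ ≤ Σ xs (λ x → ∣ f x ∣)
  ∣Σ∣ []       f = ≤-refl
  ∣Σ∣ (x ∷ xs) f = ≤-trans (∣p+q∣≤∣p∣+∣q∣ (f x) (Σ xs f)) (+-monoʳ-≤ ∣ f x ∣ (∣Σ∣ xs f))

  -- Gaussian elimination, one state at a time; the strictly superharmonic w keeps the pivots positive.
  stationary : ∀ (xs : List A) (Q : A → A → ℚ) (b w : A → ℚ) →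
    (∀ x y → 0ℚ ≤ Q x y) → (∀ x → 0ℚ < w x) → (∀ x → Σ xs (λ y → Q x y * w y) < w x) →
    ∃ λ (h : A → ℚ) → ∀ x → h x ≡ b x + Σ xs (λ y → Q x y * h y)
  stationary []       Q b w 0≤Q 0<w Qw<w = b , λ x → sym (+-identityʳ (b x))
  stationary (z ∷ zs) Q b w 0≤Q 0<w Qw<w = h , sol
    where
    q = Q z z
    s = Σ zs (λ y → Q z y * w y)
    0≤s : 0ℚ ≤ s
    0≤s = Σ-nonNeg zs (λ y → *-nonNeg (0≤Q z y) (<⇒≤ (0<w y)))
    q<1 : q < 1ℚ
    q<1 with q <? 1ℚ
    ... | yes lt = lt
    ... | no ¬lt = contradiction (begin-strict
          w z          ≡⟨ sym (*-identityˡ (w z)) ⟩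
          1ℚ * w z     ≤⟨ *-monoʳ (w z) (<⇒≤ (0<w z)) (≮⇒≥ ¬lt) ⟩
          q * w z      ≤⟨ p≤p+q 0≤s ⟩
          q * w z + s  <⟨ Qw<w z ⟩
          w z          ∎) (<-irrefl refl)
    inv = inverse (<⇒0<- q<1)
    r = proj₁ inv
    0≤r = <⇒≤ (proj₁ (proj₂ inv))
    r[1-q]≡1 : r * (1ℚ - q) ≡ 1ℚ
    r[1-q]≡1 = proj₂ (proj₂ inv)
    r≡1+rq : r ≡ 1ℚ + r * q
    r≡1+rq = trans (solve 2 (λ r q → r := r :* (con 1ℚ :- q) :+ r :* q) refl r q) (cong (_+ r * q) r[1-q]≡1)
    rs≤w : r * s ≤ w z
    rs≤w = begin
      r * s                    ≡⟨ solve 4 (λ r s q w → r :* s := r :* (q :* w :+ s :- q :* w)) refl r s q (w z) ⟩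
      r * (q * w z + s - q * w z)  ≤⟨ *-monoˡ r 0≤r (+-monoˡ-≤ (- (q * w z)) (<⇒≤ (Qw<w z))) ⟩
      r * (w z - q * w z)      ≡⟨ solve 3 (λ r q w → r :* (w :- q :* w) := (r :* (con 1ℚ :- q)) :* w) refl r q (w z) ⟩
      (r * (1ℚ - q)) * w z     ≡⟨ cong (_* w z) r[1-q]≡1 ⟩
      1ℚ * w z                 ≡⟨ *-identityˡ (w z) ⟩
      w z                      ∎
    Q′ : A → A → ℚ
    Q′ x y = Q x y + (Q x z * r) * Q z y
    b′ : A → ℚ
    b′ x = b x + (Q x z * r) * b z
    expand : ∀ x (f : A → ℚ) → Σ zs (λ y → Q′ x y * f y) ≡ Σ zs (λ y → Q x y * f y) + (Q x z * r) * Σ zs (λ y → Q z y * f y)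
    expand x f = trans
      (Σ-cong zs (λ y → solve 4 (λ a c d f → (a :+ c :* d) :* f := a :* f :+ c :* (d :* f)) refl (Q x y) (Q x z * r) (Q z y) (f y)))
      (trans (Σ-+ zs _ _) (cong (Σ zs (λ y → Q x y * f y) +_) (Σ-*ˡ zs (Q x z * r) (λ y → Q z y * f y))))
    Q′w<w : ∀ x → Σ zs (λ y → Q′ x y * w y) < w x
    Q′w<w x = begin-strict
      Σ zs (λ y → Q′ x y * w y)                           ≡⟨ expand x w ⟩
      Σ zs (λ y → Q x y * w y) + (Q x z * r) * s          ≡⟨ cong (Σ zs (λ y → Q x y * w y) +_) (*-assoc (Q x z) r s) ⟩
      Σ zs (λ y → Q x y * w y) + Q x z * (r * s)          ≤⟨ +-monoʳ-≤ (Σ zs (λ y → Q x y * w y)) (*-monoˡ (Q x z) (0≤Q x z) rs≤w) ⟩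
      Σ zs (λ y → Q x y * w y) + Q x z * w z              ≡⟨ +-comm (Σ zs (λ y → Q x y * w y)) (Q x z * w z) ⟩
      Q x z * w z + Σ zs (λ y → Q x y * w y)              <⟨ Qw<w x ⟩
      w x                                                 ∎
    rec = stationary zs Q′ b′ w
      (λ x y → +-nonNeg (0≤Q x y) (*-nonNeg (*-nonNeg (0≤Q x z) 0≤r) (0≤Q z y))) 0<w Q′w<w
    h = proj₁ rec
    t = Σ zs (λ y → Q z y * h y)
    hz : h z ≡ r * (b z + t)
    hz = begin-equality
      h z                                       ≡⟨ proj₂ rec z ⟩
      b′ z + Σ zs (λ y → Q′ z y * h y)          ≡⟨ cong (b′ z +_) (expand z h) ⟩
      (b z + (q * r) * b z) + (t + (q * r) * t) ≡⟨ solve 4 (λ b q r t → (b :+ (q :* r) :* b) :+ (t :+ (q :* r) :* t) := (con 1ℚ :+ r :* q) :* (b :+ t)) refl (b z) q r t ⟩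
      (1ℚ + r * q) * (b z + t)                  ≡⟨ cong (_* (b z + t)) (sym r≡1+rq) ⟩
      r * (b z + t)                             ∎
    sol : ∀ x → h x ≡ b x + (Q x z * h z + Σ zs (λ y → Q x y * h y))
    sol x = begin-equality
      h x                                       ≡⟨ proj₂ rec x ⟩
      b′ x + Σ zs (λ y → Q′ x y * h y)          ≡⟨ cong (b′ x +_) (expand x h) ⟩
      (b x + (Q x z * r) * b z) + (S + (Q x z * r) * t)
        ≡⟨ solve 6 (λ bx c r bz S t → (bx :+ (c :* r) :* bz) :+ (S :+ (c :* r) :* t) := bx :+ (c :* (r :* (bz :+ t)) :+ S)) refl (b x) (Q x z) r (b z) S t ⟩
      b x + (Q x z * (r * (b z + t)) + S)       ≡⟨ cong (λ k → b x + (Q x z * k + S)) (sym hz) ⟩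
      b x + (Q x z * h z + S)                   ∎
      where S = Σ zs (λ y → Q x y * h y)

  commonBound : ∀ (xs : List A) (f w : A → ℚ) → (∀ x → 0ℚ < w x) →
    ∃ λ C → ∀ {x} → x ∈ xs → f x ≤ C * w x
  commonBound []       f w 0<w = 0ℚ , λ ()
  commonBound (x ∷ xs) f w 0<w with commonBound xs f w 0<w | inverse (0<w x)
  ... | C , le | r , _ , r*w≡1 = C ⊔ (f x * r) , bound
    where
    bound : ∀ {y} → y ∈ x ∷ xs → f y ≤ (C ⊔ (f x * r)) * w y
    bound (here refl) = begin
      f x                    ≡⟨ trans (sym (*-identityʳ (f x))) (trans (cong (f x *_) (sym r*w≡1)) (sym (*-assoc (f x) r (w x)))) ⟩
      (f x * r) * w x        ≤⟨ *-monoʳ (w x) (<⇒≤ (0<w x)) (p≤q⊔p C (f x * r)) ⟩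
      (C ⊔ (f x * r)) * w x  ∎
    bound {y} (there y∈) = ≤-trans (le y∈) (*-monoʳ (w y) (<⇒≤ (0<w y)) (p≤p⊔q C (f x * r)))

  commonRatio : ∀ (xs : List A) (f w : A → ℚ) → (∀ x → 0ℚ < w x) → (∀ x → f x < w x) →
    ∃ λ ρ → 0ℚ ≤ ρ × ρ < 1ℚ × (∀ {x} → x ∈ xs → f x ≤ ρ * w x)
  commonRatio []       f w 0<w f<w = 0ℚ , ≤-refl , positive⁻¹ 1ℚ , λ ()
  commonRatio (x ∷ xs) f w 0<w f<w with commonRatio xs f w 0<w f<w | inverse (0<w x)
  ... | ρ , 0≤ρ , ρ<1 , le | r , 0<r , r*w≡1 =
    ρ ⊔ (f x * r) , ≤-trans 0≤ρ (p≤p⊔q ρ (f x * r)) , lt , bound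
    where
    fr<1 : f x * r < 1ℚ
    fr<1 = begin-strict
      f x * r  <⟨ *-monoˡ-<-pos r {{positive 0<r}} (f<w x) ⟩
      w x * r  ≡⟨ trans (*-comm (w x) r) r*w≡1 ⟩
      1ℚ       ∎
    lt : ρ ⊔ (f x * r) < 1ℚ
    lt with ⊔-sel ρ (f x * r)
    ... | inj₁ eq = subst (_< 1ℚ) (sym eq) ρ<1
    ... | inj₂ eq = subst (_< 1ℚ) (sym eq) fr<1
    bound : ∀ {y} → y ∈ x ∷ xs → f y ≤ (ρ ⊔ (f x * r)) * w y
    bound (here refl) = begin
      f x                    ≡⟨ trans (sym (*-identityʳ (f x))) (trans (cong (f x *_) (sym r*w≡1)) (sym (*-assoc (f x) r (w x)))) ⟩
      (f x * r) * w x        ≤⟨ *-monoʳ (w x) (<⇒≤ (0<w x)) (p≤q⊔p ρ (f x * r)) ⟩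
      (ρ ⊔ (f x * r)) * w x  ∎
    bound {y} (there y∈) = ≤-trans (le y∈) (*-monoʳ (w y) (<⇒≤ (0<w y)) (p≤p⊔q ρ (f x * r)))

  module Iteration (xs : List A) (every : ∀ x → x ∈ xs) (Q : A → A → ℚ) (b w : A → ℚ)
    (0≤Q : ∀ x y → 0ℚ ≤ Q x y) (0<w : ∀ x → 0ℚ < w x)
    (a : ℕ → A → ℚ) (a-step : ∀ k x → a (suc k) x ≡ b x + Σ xs (λ y → Q x y * a k y)) where

    module Error (h : A → ℚ) (h-stat : ∀ x → h x ≡ b x + Σ xs (λ y → Q x y * h y))
      (ρ C : ℚ) (0≤ρ : 0ℚ ≤ ρ) (Qw≤ρw : ∀ {x} → x ∈ xs → Σ xs (λ y → Q x y * w y) ≤ ρ * w x)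
      (start : ∀ {x} → x ∈ xs → ∣ a 0 x - h x ∣ ≤ C * w x) where

      error-step : ∀ k y → a (suc k) y - h y ≡ Σ xs (λ z → Q y z * (a k z - h z))
      error-step k y = begin-equality
        a (suc k) y - h y                ≡⟨ cong₂ _-_ (a-step k y) (h-stat y) ⟩
        (b y + sa) - (b y + sh)          ≡⟨ cancel (b y) sa sh ⟩
        sa + (- 1ℚ) * sh                 ≡⟨ cong (sa +_) (sym (Σ-*ˡ xs (- 1ℚ) (λ z → Q y z * h z))) ⟩
        sa + Σ xs (λ z → (- 1ℚ) * (Q y z * h z))
                                         ≡⟨ sym (Σ-+ xs (λ z → Q y z * a k z) (λ z → (- 1ℚ) * (Q y z * h z))) ⟩
        Σ xs (λ z → Q y z * a k z + (- 1ℚ) * (Q y z * h z))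
                                         ≡⟨ Σ-cong xs (λ z → factor (Q y z) (a k z) (h z)) ⟩
        Σ xs (λ z → Q y z * (a k z - h z)) ∎
        where
        sa = Σ xs (λ z → Q y z * a k z)
        sh = Σ xs (λ z → Q y z * h z)
        cancel : ∀ b s t → (b + s) - (b + t) ≡ s + (- 1ℚ) * t
        cancel = solve 3 (λ b s t → (b :+ s) :- (b :+ t) := s :+ (:- con 1ℚ) :* t) refl
        factor : ∀ q a h → q * a + (- 1ℚ) * (q * h) ≡ q * (a - h)
        factor = solve 3 (λ q a h → q :* a :+ (:- con 1ℚ) :* (q :* h) := q :* (a :- h)) refl

      0≤C : A → 0ℚ ≤ C
      0≤C y = *-cancelʳ-≤-pos (w y) {{positive (0<w y)}}
        (≤-trans (≤-reflexive (*-zeroˡ (w y))) (≤-trans (0≤∣p∣ (a 0 y - h y)) (start (every y))))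

      decay : ∀ k y → ∣ a k y - h y ∣ ≤ pow ρ k * (C * w y)
      decay zero    y = ≤-trans (start (every y)) (≤-reflexive (sym (*-identityˡ (C * w y))))
      decay (suc k) y = begin
        ∣ a (suc k) y - h y ∣                ≡⟨ cong ∣_∣ (error-step k y) ⟩
        ∣ Σ xs (λ z → Q y z * (a k z - h z)) ∣  ≤⟨ ∣Σ∣ xs (λ z → Q y z * (a k z - h z)) ⟩
        Σ xs (λ z → ∣ Q y z * (a k z - h z) ∣)  ≡⟨ Σ-cong xs (λ z → trans (∣p*q∣≡∣p∣*∣q∣ (Q y z) (a k z - h z)) (cong (_* ∣ a k z - h z ∣) (0≤p⇒∣p∣≡p (0≤Q y z)))) ⟩
        Σ xs (λ z → Q y z * ∣ a k z - h z ∣)  ≤⟨ Σ-mono xs (λ z → *-monoˡ (Q y z) (0≤Q y z) (decay k z)) ⟩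
        Σ xs (λ z → Q y z * (P * (C * w z))) ≡⟨ Σ-cong xs (λ z → rearrange (Q y z) P C (w z)) ⟩
        Σ xs (λ z → (P * C) * (Q y z * w z)) ≡⟨ Σ-*ˡ xs (P * C) (λ z → Q y z * w z) ⟩
        (P * C) * Σ xs (λ z → Q y z * w z)   ≤⟨ *-monoˡ (P * C) (*-nonNeg (pow-nonNeg 0≤ρ k) (0≤C y)) (Qw≤ρw (every y)) ⟩
        (P * C) * (ρ * w y)                  ≡⟨ sym (rearrange ρ P C (w y)) ⟩
        ρ * (P * (C * w y))                  ≡⟨ sym (*-assoc ρ P (C * w y)) ⟩
        (ρ * P) * (C * w y)                  ∎
        where
        P = pow ρ k
        rearrange : ∀ q p c w → q * (p * (c * w)) ≡ (p * c) * (q * w)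
        rearrange = solve 4 (λ q p c w → q :* (p :* (c :* w)) := (p :* c) :* (q :* w)) refl

      limit : ρ < 1ℚ → ∀ x → TendsTo (λ k → a k x) (h x)
      limit ρ<1 x ε 0<ε = map₂ (λ small k N≤k → ≤-<-trans (decay k x) (small k N≤k))
        (geometric (C * w x) ε 0≤ρ ρ<1 0<ε)

    converges : (∀ x → Σ xs (λ y → Q x y * w y) < w x) → ∀ x → ∃ (TendsTo (λ k → a k x))
    converges Qw<w x =
      let h , h-stat = stationary xs Q b w 0≤Q 0<w Qw<w
          ρ , 0≤ρ , ρ<1 , Qw≤ρw = commonRatio xs (λ y → Σ xs (λ z → Q y z * w z)) w 0<w Qw<w
          C , start = commonBound xs (λ y → ∣ a 0 y - h y ∣) w 0<w
      in h x , Error.limit h h-stat ρ C 0≤ρ Qw≤ρw start ρ<1 x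

  Σ-++ : ∀ (xs ys : List A) f → Σ (xs ++ ys) f ≡ Σ xs f + Σ ys f
  Σ-++ []       ys f = sym (+-identityˡ (Σ ys f))
  Σ-++ (x ∷ xs) ys f = trans (cong (f x +_) (Σ-++ xs ys f)) (sym (+-assoc (f x) (Σ xs f) (Σ ys f)))

  Σ-filter : ∀ (c : A → Bool) (xs : List A) f →
    Σ (filter (T? ∘ c) xs) f ≡ Σ xs (λ x → (if c x then 1ℚ else 0ℚ) * f x)
  Σ-filter c []       f = refl
  Σ-filter c (x ∷ xs) f with c x
  ... | true  = cong₂ _+_ (sym (*-identityˡ (f x))) (Σ-filter c xs f)
  ... | false = trans (Σ-filter c xs f)
    (sym (trans (cong (_+ Σ xs (λ x → (if c x then 1ℚ else 0ℚ) * f x)) (*-zeroˡ (f x))) (+-identityˡ _)))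

  average-cong : ∀ d (xs : List A) {f g} → (∀ x → f x ≡ g x) → average d xs f ≡ average d xs g
  average-cong d []       eq = refl
  average-cong d (x ∷ xs) eq = cong ((ℤ.+ 1 / length (x ∷ xs)) *_) (Σ-cong (x ∷ xs) eq)

  average-const : ∀ d (xs : List A) → average d xs (λ _ → d) ≡ d
  average-const d []       = refl
  average-const d (x ∷ xs) = begin-equality
    i * Σ (x ∷ xs) (λ _ → d)         ≡⟨ cong (i *_) (Σ-const (x ∷ xs) d) ⟩
    i * (nat (length (x ∷ xs)) * d)  ≡⟨ sym (*-assoc i (nat (length (x ∷ xs))) d) ⟩
    i * nat (length (x ∷ xs)) * d    ≡⟨ cong (_* d) (1/n*n (length xs)) ⟩
    1ℚ * d                           ≡⟨ *-identityˡ d ⟩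
    d                                ∎
    where i = ℤ.+ 1 / length (x ∷ xs)

Σ-map : ∀ {A B : Set} (g : A → B) xs f → Σ (map g xs) f ≡ Σ xs (f ∘ g)
Σ-map g []       f = refl
Σ-map g (x ∷ xs) f = cong (f (g x) +_) (Σ-map g xs f)

Σ-× : ∀ {A B : Set} (xs : List A) (ys : List B) f →
  Σ (cartesianProduct xs ys) f ≡ Σ xs (λ x → Σ ys (λ y → f (x , y)))
Σ-× []       ys f = refl
Σ-× (x ∷ xs) ys f = trans (Σ-++ (map (x ,_) ys) (cartesianProduct xs ys) f)
  (cong₂ _+_ (Σ-map (x ,_) ys f) (Σ-× xs ys f))

allVecs : ∀ n → List (Vec Bool n)
allVecs zero    = [ [] ]
allVecs (suc n) = map (true ∷_) (allVecs n) ++ map (false ∷_) (allVecs n)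

∈-allVecs : ∀ {n} (S : Vec Bool n) → S ∈ allVecs n
∈-allVecs []          = here refl
∈-allVecs (true  ∷ S) = ∈-++⁺ˡ (∈-map⁺ (true ∷_) (∈-allVecs S))
∈-allVecs {suc n} (false ∷ S) = ∈-++⁺ʳ (map (true ∷_) (allVecs n)) (∈-map⁺ (false ∷_) (∈-allVecs S))

δ : ∀ {n} → Vec Bool n → Vec Bool n → ℚ
δ []          []          = 1ℚ
δ (true  ∷ S) (true  ∷ U) = δ S U
δ (false ∷ S) (false ∷ U) = δ S U
δ (true  ∷ S) (false ∷ U) = 0ℚ
δ (false ∷ S) (true  ∷ U) = 0ℚ

δ-nonNeg : ∀ {n} (S U : Vec Bool n) → 0ℚ ≤ δ S U
δ-nonNeg []          []          = nonNegative⁻¹ 1ℚ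
δ-nonNeg (true  ∷ S) (true  ∷ U) = δ-nonNeg S U
δ-nonNeg (false ∷ S) (false ∷ U) = δ-nonNeg S U
δ-nonNeg (true  ∷ S) (false ∷ U) = ≤-refl
δ-nonNeg (false ∷ S) (true  ∷ U) = ≤-refl

Σ-zero : ∀ {A : Set} (xs : List A) (f : A → ℚ) → Σ xs (λ x → 0ℚ * f x) ≡ 0ℚ
Σ-zero xs f = trans (Σ-*ˡ xs 0ℚ f) (*-zeroˡ (Σ xs f))

Σ-δ : ∀ {n} (S : Vec Bool n) (f : Vec Bool n → ℚ) → Σ (allVecs n) (λ U → δ U S * f U) ≡ f S
Σ-δ [] f = trans (+-identityʳ (1ℚ * f [])) (*-identityˡ (f []))
Σ-δ {suc n} (true ∷ S) f = trans (Σ-++ (map (true ∷_) (allVecs n)) (map (false ∷_) (allVecs n)) g)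
  (trans (cong₂ _+_ (trans (Σ-map (true ∷_) (allVecs n) g) (Σ-δ S (λ U → f (true ∷ U))))
                    (trans (Σ-map (false ∷_) (allVecs n) g) (Σ-zero (allVecs n) (λ U → f (false ∷ U)))))
         (+-identityʳ (f (true ∷ S))))
  where
  g : Vec Bool (suc n) → ℚ
  g U = δ U (true ∷ S) * f U
Σ-δ {suc n} (false ∷ S) f = trans (Σ-++ (map (true ∷_) (allVecs n)) (map (false ∷_) (allVecs n)) g)
  (trans (cong₂ _+_ (trans (Σ-map (true ∷_) (allVecs n) g) (Σ-zero (allVecs n) (λ U → f (true ∷ U))))
                    (trans (Σ-map (false ∷_) (allVecs n) g) (Σ-δ S (λ U → f (false ∷ U)))))
         (+-identityˡ (f (false ∷ S))))
  where
  g : Vec Bool (suc n) → ℚ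
  g U = δ U (false ∷ S) * f U

module Absorption (G : Digraph) (conn : Connected G) (v : Digraph.Vertex G) where
  open Digraph G

  vs : List Vertex
  vs = allFin order

  𝔼-cong : ∀ k u {f g : List Vertex → ℚ} → (∀ w → f w ≡ g w) → 𝔼 G k u f ≡ 𝔼 G k u g
  𝔼-cong zero    u eq = eq [ u ]
  𝔼-cong (suc k) u {f} {g} eq = trans
    (cong (λ d → average d (outNeighbors u) (λ y → 𝔼 G k y (f ∘ (u ∷_)))) (eq [ u ]))
    (average-cong (g [ u ]) (outNeighbors u) (λ y → 𝔼-cong k y (λ w → eq (u ∷ w))))

  𝔼-const : ∀ k u c → 𝔼 G k u (λ _ → c) ≡ c
  𝔼-const zero    u c = refl
  𝔼-const (suc k) u c = trans (average-cong c (outNeighbors u) (λ y → 𝔼-const k y c)) (average-const c (outNeighbors u))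

  recip : List Vertex → ℚ
  recip []       = 0ℚ
  recip (x ∷ xs) = ℤ.+ 1 / suc (length xs)

  recip-nonNeg : ∀ xs → 0ℚ ≤ recip xs
  recip-nonNeg []       = ≤-refl
  recip-nonNeg (x ∷ xs) = <⇒≤ (0<1/n (length xs))

  recip-pos : ∀ {x xs} → x ∈ xs → 0ℚ < recip xs
  recip-pos {xs = x ∷ xs} _ = 0<1/n (length xs)

  recip-Σ : ∀ xs → recip xs * Σ xs (λ _ → 1ℚ) ≤ 1ℚ
  recip-Σ []       = nonNegative⁻¹ 1ℚ
  recip-Σ (x ∷ xs) = ≤-reflexive (average-const 1ℚ (x ∷ xs))

  average-recip : ∀ {x xs} d f → x ∈ xs → average d xs f ≡ recip xs * Σ xs f
  average-recip {xs = _ ∷ _} d f _ = refl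

  -- Transition probabilities of the walk killed at v.
  rate : Vertex → ℚ
  rate u = if does (u ≟ v) then 0ℚ else recip (outNeighbors u)

  rate-v : rate v ≡ 0ℚ
  rate-v rewrite dec-true (v ≟ v) refl = refl

  rate-≢ : ∀ {u} → u ≢ v → rate u ≡ recip (outNeighbors u)
  rate-≢ {u} u≢v rewrite dec-false (u ≟ v) u≢v = refl

  rate-nonNeg : ∀ u → 0ℚ ≤ rate u
  rate-nonNeg u with does (u ≟ v)
  ... | true  = ≤-refl
  ... | false = recip-nonNeg (outNeighbors u)

  link : Vertex → Vertex → ℚ
  link u y = if adj u y then 1ℚ else 0ℚ

  link-nonNeg : ∀ u y → 0ℚ ≤ link u y
  link-nonNeg u y with adj u y
  ... | true  = nonNegative⁻¹ 1ℚ
  ... | false = ≤-refl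

  link-edge : ∀ u y → Edge u y → link u y ≡ 1ℚ
  link-edge u y e with adj u y
  ... | true  = refl

  p : Vertex → Vertex → ℚ
  p u y = rate u * link u y

  p-nonNeg : ∀ u y → 0ℚ ≤ p u y
  p-nonNeg u y = *-nonNeg (rate-nonNeg u) (link-nonNeg u y)

  Σp : ∀ u f → Σ vs (λ y → p u y * f y) ≡ rate u * Σ (outNeighbors u) f
  Σp u f = trans (Σ-cong vs (λ y → *-assoc (rate u) (link u y) (f y)))
    (trans (Σ-*ˡ vs (rate u) (λ y → link u y * f y)) (cong (rate u *_) (sym (Σ-filter (adj u) vs f))))

  Σp-v : ∀ f → Σ vs (λ y → p v y * f y) ≡ 0ℚ
  Σp-v f = trans (Σp v f) (trans (cong (_* Σ (outNeighbors v) f) rate-v) (*-zeroˡ (Σ (outNeighbors v) f)))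

  out : ∀ {u x} → Edge u x → x ∈ outNeighbors u
  out {u} {x} e = ∈-filter⁺ (T? ∘ adj u) (∈-allFin x) e

  someOut : ∀ {u} → u ≢ v → ∃ (_∈ outNeighbors u)
  someOut {u} u≢v with conn u v
  ... | Star.ε = contradiction refl u≢v
  ... | e ◅ _ = _ , out e

  Σp-average : ∀ {u} → u ≢ v → ∀ d f → average d (outNeighbors u) f ≡ Σ vs (λ y → p u y * f y)
  Σp-average {u} u≢v d f = trans (average-recip d f (proj₂ (someOut u≢v)))
    (trans (cong (_* Σ (outNeighbors u) f) (sym (rate-≢ u≢v))) (sym (Σp u f)))

  Σp1≤1 : ∀ u → Σ vs (λ y → p u y * 1ℚ) ≤ 1ℚ
  Σp1≤1 u = byCase (u ≟ v)
    where
    byCase : Dec (u ≡ v) → Σ vs (λ y → p u y * 1ℚ) ≤ 1ℚ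
    byCase (yes refl) = ≤-trans (≤-reflexive (Σp-v (λ _ → 1ℚ))) (nonNegative⁻¹ 1ℚ)
    byCase (no u≢v)   = ≤-trans
      (≤-reflexive (trans (Σp u (λ _ → 1ℚ)) (cong (_* Σ (outNeighbors u) (λ _ → 1ℚ)) (rate-≢ u≢v))))
      (recip-Σ (outNeighbors u))

  -- Probability that the walk is not killed in k steps.
  alive : ℕ → Vertex → ℚ
  alive zero    u = 1ℚ
  alive (suc k) u = Σ vs (λ y → p u y * alive k y)

  alive-step : ∀ k u → alive (suc k) u ≤ alive k u
  alive-step zero    u = Σp1≤1 u
  alive-step (suc k) u = Σ-mono vs (λ y → *-monoˡ (p u y) (p-nonNeg u y) (alive-step k y))

  alive-≤ : ∀ {j k} → j ℕ.≤′ k → ∀ u → alive k u ≤ alive j u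
  alive-≤ ℕ.≤′-refl                u = ≤-refl
  alive-≤ {k = suc k} (ℕ.≤′-step j≤k) u = ≤-trans (alive-step k u) (alive-≤ j≤k u)

  alive-≤1 : ∀ k u → alive k u ≤ 1ℚ
  alive-≤1 k u = alive-≤ {0} {k} (ℕ.≤⇒≤′ ℕ.z≤n) u

  alive-<1 : ∀ {u} → Star Edge u v → ∃ λ k → alive k u < 1ℚ
  alive-<1 Star.ε = 1 , ≤-<-trans (≤-reflexive (Σp-v (λ _ → 1ℚ))) (positive⁻¹ 1ℚ)
  alive-<1 {u} (_◅_ {j = x} e walk) = suc k , byCase (u ≟ v)
    where
    k = proj₁ (alive-<1 walk)
    byCase : Dec (u ≡ v) → alive (suc k) u < 1ℚ
    byCase (yes refl) = ≤-<-trans (≤-reflexive (Σp-v (alive k))) (positive⁻¹ 1ℚ)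
    byCase (no u≢v)   = <-≤-trans
      (Σ-mono-< vs (λ y → *-monoˡ (p u y) (p-nonNeg u y) (alive-≤1 k y)) (∈-allFin x)
        (*-monoʳ-<-pos (p u x) {{positive 0<p}} (proj₂ (alive-<1 walk))))
      (Σp1≤1 u)
      where
      0<p : 0ℚ < p u x
      0<p = *-pos (subst (0ℚ <_) (sym (rate-≢ u≢v)) (recip-pos (out e)))
                  (subst (0ℚ <_) (sym (link-edge u x e)) (positive⁻¹ 1ℚ))

  horizon : ∀ (xs : List Vertex) → ∃ λ N → ∀ {u} → u ∈ xs → alive N u < 1ℚ
  horizon []       = 0 , λ ()
  horizon (x ∷ xs) with horizon xs | alive-<1 (conn x v)
  ... | N , lts | k , lt = N ℕ.⊔ k , bound
    where
    bound : ∀ {u} → u ∈ x ∷ xs → alive (N ℕ.⊔ k) u < 1ℚ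
    bound {u} (here refl) = ≤-<-trans (alive-≤ {k} {N ℕ.⊔ k} (ℕ.≤⇒≤′ (ℕ.m≤n⊔m N k)) u) lt
    bound {u} (there u∈)  = ≤-<-trans (alive-≤ {N} {N ℕ.⊔ k} (ℕ.≤⇒≤′ (ℕ.m≤m⊔n N k)) u) (lts u∈)

  -- Expected number of steps made by the killed walk, counting up to k.
  steps : ℕ → Vertex → ℚ
  steps zero    u = 0ℚ
  steps (suc k) u = alive k u + steps k u

  alive-nonNeg : ∀ k u → 0ℚ ≤ alive k u
  alive-nonNeg zero    u = nonNegative⁻¹ 1ℚ
  alive-nonNeg (suc k) u = Σ-nonNeg vs (λ y → *-nonNeg (p-nonNeg u y) (alive-nonNeg k y))

  steps-nonNeg : ∀ k u → 0ℚ ≤ steps k u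
  steps-nonNeg zero    u = ≤-refl
  steps-nonNeg (suc k) u = +-nonNeg (alive-nonNeg k u) (steps-nonNeg k u)

  steps-rec : ∀ k u → Σ vs (λ y → p u y * steps k y) + 1ℚ ≡ steps k u + alive k u
  steps-rec zero u = cong (_+ 1ℚ) (trans (Σ-cong vs (λ y → *-zeroʳ (p u y))) (Σ-0 vs))
  steps-rec (suc k) u = begin-equality
    Σ vs (λ y → p u y * (alive k y + steps k y)) + 1ℚ
      ≡⟨ cong (_+ 1ℚ) (trans (Σ-cong vs (λ y → *-distribˡ-+ (p u y) (alive k y) (steps k y))) (Σ-+ vs (λ y → p u y * alive k y) (λ y → p u y * steps k y))) ⟩
    alive (suc k) u + Σ vs (λ y → p u y * steps k y) + 1ℚ
      ≡⟨ +-assoc (alive (suc k) u) _ 1ℚ ⟩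
    alive (suc k) u + (Σ vs (λ y → p u y * steps k y) + 1ℚ)
      ≡⟨ cong (alive (suc k) u +_) (steps-rec k u) ⟩
    alive (suc k) u + (steps k u + alive k u)
      ≡⟨ trans (+-comm (alive (suc k) u) _) (cong (_+ alive (suc k) u) (+-comm (steps k u) (alive k u))) ⟩
    alive k u + steps k u + alive (suc k) u ∎

  steps-super : ∀ N u → alive N u < 1ℚ → Σ vs (λ y → p u y * steps N y) < steps N u
  steps-super N u lt = begin-strict
    s                              ≡⟨ add-sub s 1ℚ ⟩
    (s + 1ℚ) + - 1ℚ                ≡⟨ cong (_+ - 1ℚ) (steps-rec N u) ⟩
    (steps N u + alive N u) + - 1ℚ <⟨ +-monoˡ-< (- 1ℚ) (+-monoʳ-< (steps N u) lt) ⟩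
    (steps N u + 1ℚ) + - 1ℚ        ≡⟨ sym (add-sub (steps N u) 1ℚ) ⟩
    steps N u                      ∎
    where
    s = Σ vs (λ y → p u y * steps N y)
    add-sub : ∀ a c → a ≡ (a + c) + - c
    add-sub = solve 2 (λ a c → a := (a :+ c) :+ (:- c)) refl

  -- (S , u) stands for a walk at u that visited S before.
  State : Set
  State = Vec Bool order × Vertex

  states : List State
  states = cartesianProduct (allVecs order) vs

  every : ∀ s → s ∈ states
  every (S , u) = ∈-cartesianProduct⁺ (∈-allVecs S) (∈-allFin u)

  AllSeen : Vec Bool order → Set
  AllSeen S = ∀ z → z ≢ v → lookup S z ≡ true

  allSeen? : ∀ S → Dec (AllSeen S)
  allSeen? S = all? (λ z → ¬? (z ≟ v) →-dec (lookup S z Bool.≟ true))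

  payoff : Vec Bool order → List Vertex → ℚ
  payoff S []      = 0ℚ
  payoff S (x ∷ w) = if does (x ≟ v) then 𝟙 (allSeen? S) else payoff (S [ x ]≔ true) w

  payoff-v : ∀ S w → payoff S (v ∷ w) ≡ 𝟙 (allSeen? S)
  payoff-v S w rewrite dec-true (v ≟ v) refl = refl

  payoff-≢ : ∀ S {x} w → x ≢ v → payoff S (x ∷ w) ≡ payoff (S [ x ]≔ true) w
  payoff-≢ S {x} w x≢v rewrite dec-false (x ≟ v) x≢v = refl

  b : State → ℚ
  b (S , u) = if does (u ≟ v) then 𝟙 (allSeen? S) else 0ℚ

  b-v : ∀ S → b (S , v) ≡ 𝟙 (allSeen? S)
  b-v S rewrite dec-true (v ≟ v) refl = refl

  b-≢ : ∀ S {u} → u ≢ v → b (S , u) ≡ 0ℚ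
  b-≢ S {u} u≢v rewrite dec-false (u ≟ v) u≢v = refl

  Q : State → State → ℚ
  Q (S , u) (U , y) = δ U (S [ u ]≔ true) * p u y

  Q-nonNeg : ∀ s t → 0ℚ ≤ Q s t
  Q-nonNeg (S , u) (U , y) = *-nonNeg (δ-nonNeg U (S [ u ]≔ true)) (p-nonNeg u y)

  ΣQ : ∀ S u (f : State → ℚ) → Σ states (λ t → Q (S , u) t * f t) ≡ Σ vs (λ y → p u y * f (S [ u ]≔ true , y))
  ΣQ S u f = begin-equality
    Σ states (λ t → Q (S , u) t * f t)
      ≡⟨ Σ-× (allVecs order) vs _ ⟩
    Σ (allVecs order) (λ U → Σ vs (λ y → (δ U S′ * p u y) * f (U , y)))
      ≡⟨ Σ-cong (allVecs order) (λ U → trans (Σ-cong vs (λ y → *-assoc (δ U S′) (p u y) (f (U , y)))) (Σ-*ˡ vs (δ U S′) _)) ⟩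
    Σ (allVecs order) (λ U → δ U S′ * Σ vs (λ y → p u y * f (U , y)))
      ≡⟨ Σ-δ S′ (λ U → Σ vs (λ y → p u y * f (U , y))) ⟩
    Σ vs (λ y → p u y * f (S′ , y)) ∎
    where S′ = S [ u ]≔ true

  a : ℕ → State → ℚ
  a k (S , u) = 𝔼 G k u (payoff S)

  a-step : ∀ k s → a (suc k) s ≡ b s + Σ states (λ t → Q s t * a k t)
  a-step k (S , u) = trans (byCase (u ≟ v)) (cong (b (S , u) +_) (sym (ΣQ S u (a k))))
    where
    byCase : Dec (u ≡ v) → a (suc k) (S , u) ≡ b (S , u) + Σ vs (λ y → p u y * a k (S [ u ]≔ true , y))
    byCase (yes refl) = begin-equality
      average (payoff S [ v ]) (outNeighbors v) (λ y → 𝔼 G k y (λ w → payoff S (v ∷ w)))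
        ≡⟨ cong (λ d → average d (outNeighbors v) (λ y → 𝔼 G k y (λ w → payoff S (v ∷ w)))) (payoff-v S []) ⟩
      average c (outNeighbors v) (λ y → 𝔼 G k y (λ w → payoff S (v ∷ w)))
        ≡⟨ average-cong c (outNeighbors v) (λ y → trans (𝔼-cong k y (payoff-v S)) (𝔼-const k y c)) ⟩
      average c (outNeighbors v) (λ _ → c)
        ≡⟨ average-const c (outNeighbors v) ⟩
      c ≡⟨ sym (b-v S) ⟩
      b (S , v) ≡⟨ sym (+-identityʳ (b (S , v))) ⟩
      b (S , v) + 0ℚ ≡⟨ cong (b (S , v) +_) (sym (Σp-v (λ y → a k (S [ v ]≔ true , y)))) ⟩
      b (S , v) + Σ vs (λ y → p v y * a k (S [ v ]≔ true , y)) ∎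
      where c = 𝟙 (allSeen? S)
    byCase (no u≢v) = begin-equality
      average (payoff S [ u ]) (outNeighbors u) (λ y → 𝔼 G k y (λ w → payoff S (u ∷ w)))
        ≡⟨ average-cong (payoff S [ u ]) (outNeighbors u) (λ y → 𝔼-cong k y (λ w → payoff-≢ S w u≢v)) ⟩
      average (payoff S [ u ]) (outNeighbors u) (λ y → a k (S [ u ]≔ true , y))
        ≡⟨ Σp-average u≢v (payoff S [ u ]) (λ y → a k (S [ u ]≔ true , y)) ⟩
      r ≡⟨ sym (+-identityˡ r) ⟩
      0ℚ + r ≡⟨ cong (_+ r) (sym (b-≢ S u≢v)) ⟩
      b (S , u) + r ∎
      where r = Σ vs (λ y → p u y * a k (S [ u ]≔ true , y))

  a-limit : ∀ s → ∃ (TendsTo (λ k → a k s))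
  a-limit = Iteration.converges states every Q b w Q-nonNeg w-pos a a-step Qw<w
    where
    N : ℕ
    N = proj₁ (horizon vs)
    w : State → ℚ
    w (S , u) = steps N u
    super : ∀ u → Σ vs (λ y → p u y * steps N y) < steps N u
    super u = steps-super N u (proj₂ (horizon vs) (∈-allFin u))
    w-pos : ∀ s → 0ℚ < w s
    w-pos (S , u) = ≤-<-trans (Σ-nonNeg vs (λ y → *-nonNeg (p-nonNeg u y) (steps-nonNeg N y))) (super u)
    Qw<w : ∀ s → Σ states (λ t → Q s t * w t) < w s
    Qw<w (S , u) = ≤-<-trans (≤-reflexive (ΣQ S u w)) (super u)

  Wins : Vec Bool order → List Vertex → Set
  Wins S w = v ∈ w × (∀ z → z ≢ v → lookup S z ≡ true ⊎ z ∈ before G v w)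

  𝟙-cong : ∀ {P R : Set} (P? : Dec P) (R? : Dec R) → (P → R) → (R → P) → 𝟙 P? ≡ 𝟙 R?
  𝟙-cong (yes _) (yes _) _ _ = refl
  𝟙-cong (no _)  (no _)  _ _ = refl
  𝟙-cong (yes q) (no ¬r) f _ = contradiction (f q) ¬r
  𝟙-cong (no ¬q) (yes r) _ g = contradiction (g r) ¬q

  before-v : ∀ w → before G v (v ∷ w) ≡ []
  before-v w rewrite dec-true (v ≟ v) refl = refl

  before-≢ : ∀ {x} w → x ≢ v → before G v (x ∷ w) ≡ x ∷ before G v w
  before-≢ {x} w x≢v rewrite dec-false (x ≟ v) x≢v = refl

  payoff-wins : ∀ S w (d : Dec (Wins S w)) → payoff S w ≡ 𝟙 d
  payoff-wins S []      (yes (() , _))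
  payoff-wins S []      (no _) = refl
  payoff-wins S (x ∷ w) d = byCase (x ≟ v)
    where
    byCase : Dec (x ≡ v) → payoff S (x ∷ w) ≡ 𝟙 d
    byCase (yes refl) = trans (payoff-v S w) (𝟙-cong (allSeen? S) d to from)
      where
      to : AllSeen S → Wins S (v ∷ w)
      to seen = here refl , λ z z≢v → inj₁ (seen z z≢v)
      from : Wins S (v ∷ w) → AllSeen S
      from (_ , wins) z z≢v with wins z z≢v
      ... | inj₁ eq = eq
      ... | inj₂ z∈ with subst (z ∈_) (before-v w) z∈
      ...   | ()
    byCase (no x≢v) = trans (payoff-≢ S w x≢v) (payoff-wins (S [ x ]≔ true) w (map′ to from d))
      where
      to : Wins S (x ∷ w) → Wins (S [ x ]≔ true) w
      to (there v∈ , wins) = v∈ , λ z z≢v → sub z z≢v (z ≟ x)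
        where
        sub : ∀ z → z ≢ v → Dec (z ≡ x) → lookup (S [ x ]≔ true) z ≡ true ⊎ z ∈ before G v w
        sub z z≢v (yes refl) = inj₁ (lookup∘updateAt z S)
        sub z z≢v (no z≢x) with wins z z≢v
        ... | inj₁ eq = inj₁ (trans (lookup∘updateAt′ z x z≢x S) eq)
        ... | inj₂ z∈ with subst (z ∈_) (before-≢ w x≢v) z∈
        ...   | here z≡x  = contradiction z≡x z≢x
        ...   | there z∈′ = inj₂ z∈′
      to (here v≡x , _) = contradiction (sym v≡x) x≢v
      from : Wins (S [ x ]≔ true) w → Wins S (x ∷ w)
      from (v∈ , wins) = there v∈ , λ z z≢v → sub z z≢v (z ≟ x)
        where
        sub : ∀ z → z ≢ v → Dec (z ≡ x) → lookup S z ≡ true ⊎ z ∈ before G v (x ∷ w)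
        sub z z≢v (yes refl) = inj₂ (subst (z ∈_) (sym (before-≢ w x≢v)) (here refl))
        sub z z≢v (no z≢x) with wins z z≢v
        ... | inj₁ eq = inj₁ (trans (sym (lookup∘updateAt′ z x z≢x S)) eq)
        ... | inj₂ z∈ = inj₂ (subst (z ∈_) (sym (before-≢ w x≢v)) (there z∈))

  ∅ : Vec Bool order
  ∅ = replicate order false

  payoff-∅ : ∀ w → payoff ∅ w ≡ 𝟙 (lastVisited? G v w)
  payoff-∅ w = payoff-wins ∅ w (map′ to from (lastVisited? G v w))
    where
    to : LastVisited G v w → Wins ∅ w
    to (v∈ , last) = v∈ , λ z z≢v → inj₂ (last z z≢v)
    from : Wins ∅ w → LastVisited G v w
    from (v∈ , wins) = v∈ , λ z z≢v → sub z (wins z z≢v)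
      where
      sub : ∀ z → lookup ∅ z ≡ true ⊎ z ∈ before G v w → z ∈ before G v w
      sub z (inj₂ z∈) = z∈
      sub z (inj₁ eq) with trans (sym (lookup-replicate z false)) eq
      ... | ()

  exists : ∀ u → ∃ (TendsTo (λ k → ℙLWithin G k u v))
  exists u = map₂ (λ {q} lim ε 0<ε → map₂ (λ small k N≤k →
    subst (λ r → ∣ r - q ∣ < ε) (𝔼-cong k u payoff-∅) (small k N≤k)) (lim ε 0<ε)) (a-limit (∅ , u))

abstract

  ℙL : (G : Digraph) → Connected G → (u v : Digraph.Vertex G) → ℚ
  ℙL G conn u v = proj₁ (Absorption.exists G conn v u)

  ℙL-limit : ∀ G conn u v → TendsTo (λ k → ℙLWithin G k u v) (ℙL G conn u v)
  ℙL-limit G conn u v = proj₂ (Absorption.exists G conn v u)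

{-# OPTIONS --safe #-}
module Submission where

-- Conditioning on the first step, ℙ(L(u,v)) is the average over the out-neighbors y of u of the
-- probability that v comes last in a tour from y for which u already counts as visited. That
-- probability is at least ℙ(L(y,v)), so some out-neighbor x has ℙ(L(x,v)) ≤ ℙ(L(u,v)). A walk as in
-- the second claim is followed with positive probability, and then v comes last only thanks to
-- u counting as visited, which makes the comparison of averages strict.

open import Defs
open import Data.Bool.Base using (Bool; true; false)
open import Data.Bool.Properties using (T?)
open import Data.Fin.Properties using (_≟_)
import Data.Integer.Base as ℤ
open import Data.List.Base using (List; []; _∷_; _∷ʳ_; length)
open import Data.List.Membership.Propositional using (_∈_; _∉_)
open import Data.List.Membership.Propositional.Properties using (∈-allFin; ∈-filter⁻; ∈-++⁺ˡ; ∈-++⁻)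
open import Data.List.Relation.Unary.Any using (here; there)
open import Data.List.Relation.Unary.Linked using (Linked; _∷_)
open import Data.Nat.Base as ℕ using (ℕ; zero; suc)
import Data.Nat.Properties as ℕ
open import Data.Product using (_×_; ∃; _,_; proj₂; map₂)
open import Data.Rational using (ℚ; 0ℚ; 1ℚ; _+_; _*_; _-_; -_; _≤_; _<_; ∣_∣; _/_)
open import Data.Rational.Properties using (≤-refl; ≤-trans; ≤-reflexive; <⇒≤; <-irrefl; ≤-<-trans; <-≤-trans; ≰⇒>; ≮⇒≥; _≤?_; _<?_; +-mono-≤; +-mono-<-≤; +-mono-<; +-monoˡ-<; +-monoʳ-<; +-identityˡ; +-identityʳ; +-inverseʳ; *-identityˡ; *-distribˡ-+; *-comm; *-assoc; ≤-total; 0≤∣p∣; 0≤p⇒∣p∣≡p; ∣-p∣≡∣p∣; ∣p+q∣≤∣p∣+∣q∣; <-dense; positive⁻¹; nonNegative⁻¹; module ≤-Reasoning)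
open import Data.Rational.Solver using (module +-*-Solver)
open import Data.Sum.Base using (_⊎_; inj₁; inj₂)
open import Data.Vec.Base using (Vec; lookup; _[_]≔_)
open import Data.Vec.Properties using (lookup∘updateAt; lookup∘updateAt′; lookup-replicate)
open import Function.Base using (_∘_)
open import Relation.Binary.PropositionalEquality using (_≡_; _≢_; refl; sym; ≢-sym; trans; cong; subst)
open import Relation.Nullary using (Dec; yes; no; ¬_; contradiction)

open ≤-Reasoning
open +-*-Solver using (solve; _:=_; _:+_; _:-_; :-_)

-- Limits of rational sequences

p≤∣p∣ : ∀ p → p ≤ ∣ p ∣
p≤∣p∣ p with ≤-total 0ℚ p
... | inj₁ 0≤p = ≤-reflexive (sym (0≤p⇒∣p∣≡p 0≤p))
... | inj₂ p≤0 = ≤-trans p≤0 (0≤∣p∣ p)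

TendsTo-cong : ∀ {f g : ℕ → ℚ} {p} → (∀ k → f k ≡ g k) → TendsTo f p → TendsTo g p
TendsTo-cong {p = p} eq lim ε 0<ε =
  map₂ (λ close k N≤k → subst (λ r → ∣ r - p ∣ < ε) (eq k) (close k N≤k)) (lim ε 0<ε)

TendsTo-const : ∀ c → TendsTo (λ _ → c) c
TendsTo-const c ε 0<ε = 0 , λ _ _ → subst (_< ε) (sym (cong ∣_∣ (+-inverseʳ c))) 0<ε

TendsTo-suc : ∀ {f p} → TendsTo f p → TendsTo (f ∘ suc) p
TendsTo-suc lim ε 0<ε = map₂ (λ close k N≤k → close (suc k) (ℕ.m≤n⇒m≤1+n N≤k)) (lim ε 0<ε)

TendsTo-+ : ∀ {f g p q} → TendsTo f p → TendsTo g q → TendsTo (λ k → f k + g k) (p + q)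
TendsTo-+ {f} {g} {p} {q} limf limg ε 0<ε with <-dense 0<ε
... | η , 0<η , η<ε with limf η 0<η | limg (ε - η) (<⇒0<- η<ε)
... | M , closef | N , closeg = M ℕ.⊔ N , λ k le → begin-strict
  ∣ f k + g k - (p + q) ∣      ≡⟨ cong ∣_∣ (regroup (f k) (g k) p q) ⟩
  ∣ (f k - p) + (g k - q) ∣    ≤⟨ ∣p+q∣≤∣p∣+∣q∣ (f k - p) (g k - q) ⟩
  ∣ f k - p ∣ + ∣ g k - q ∣    <⟨ +-mono-< (closef k (ℕ.m⊔n≤o⇒m≤o M N le)) (closeg k (ℕ.m⊔n≤o⇒n≤o M N le)) ⟩
  η + (ε - η)                  ≡⟨ solve 2 (λ η ε → η :+ (ε :- η) := ε) refl η ε ⟩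
  ε                            ∎
  where
  regroup : ∀ a b c d → a + b - (c + d) ≡ (a - c) + (b - d)
  regroup = solve 4 (λ a b c d → a :+ b :- (c :+ d) := (a :- c) :+ (b :- d)) refl

TendsTo-Σ : ∀ {A : Set} (xs : List A) {f : ℕ → A → ℚ} {h : A → ℚ} →
  (∀ x → TendsTo (λ k → f k x) (h x)) → TendsTo (λ k → Σ xs (f k)) (Σ xs h)
TendsTo-Σ []       lim = TendsTo-const 0ℚ
TendsTo-Σ (x ∷ xs) {f} {h} lim = TendsTo-+ {λ k → f k x} {λ k → Σ xs (f k)} {h x} {Σ xs h} (lim x) (TendsTo-Σ xs {f} {h} lim)

-- If `q < p`, a rational `m` strictly between them would eventually separate the sequences as
-- `g k < m < f k`. An eventual comparison matters because the gain for a given walk shows only once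
-- `k` allows the whole walk.
TendsTo-≤ : ∀ {f g p q} → TendsTo f p → TendsTo g q →
  (∃ λ N → ∀ k → N ℕ.≤ k → f k ≤ g k) → p ≤ q
TendsTo-≤ {f} {g} {p} {q} limf limg (L , f≤g) with p ≤? q
... | yes p≤q = p≤q
... | no  p≰q with <-dense (≰⇒> p≰q)
... | m , q<m , m<p with limf (p - m) (<⇒0<- m<p) | limg (m - q) (<⇒0<- q<m)
... | M , closef | N , closeg = contradiction (begin-strict
  m                        ≡⟨ solve 2 (λ m p → m := p :- (p :- m)) refl m p ⟩
  p - (p - m)              <⟨ below ⟩
  f k                      ≤⟨ f≤g k (ℕ.m⊔n≤o⇒m≤o L (M ℕ.⊔ N) ℕ.≤-refl) ⟩
  g k                      ≡⟨ solve 2 (λ b q → b := (b :- q) :+ q) refl (g k) q ⟩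
  (g k - q) + q            <⟨ +-monoˡ-< q (≤-<-trans (p≤∣p∣ (g k - q)) (closeg k N≤k)) ⟩
  (m - q) + q              ≡⟨ solve 2 (λ m q → (m :- q) :+ q := m) refl m q ⟩
  m                        ∎) (<-irrefl refl)
  where
  k = L ℕ.⊔ (M ℕ.⊔ N)
  MN≤k : M ℕ.⊔ N ℕ.≤ k
  MN≤k = ℕ.m≤n⊔m L (M ℕ.⊔ N)
  N≤k = ℕ.m⊔n≤o⇒n≤o M N MN≤k
  close : - (f k - p) < p - m
  close = ≤-<-trans (p≤∣p∣ (- (f k - p)))
    (subst (_< p - m) (sym (∣-p∣≡∣p∣ (f k - p))) (closef k (ℕ.m⊔n≤o⇒m≤o M N MN≤k)))
  below : p - (p - m) < f k
  below = begin-strict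
    p - (p - m)                      ≡⟨ solve 3 (λ p m a → p :- (p :- m) := (:- (a :- p)) :+ (a :- (p :- m))) refl p m (f k) ⟩
    - (f k - p) + (f k - (p - m))    <⟨ +-monoˡ-< (f k - (p - m)) close ⟩
    (p - m) + (f k - (p - m))        ≡⟨ solve 2 (λ d a → d :+ (a :- d) := a) refl (p - m) (f k) ⟩
    f k                              ∎

-- Comparison of finite sums

module _ {A : Set} where

  -- The surplus `c` is kept explicit because a bare `<` at each `k` could become an equality in the
  -- limit.
  Σ-gain : ∀ (xs : List A) {f g z c} → (∀ x → f x ≤ g x) → z ∈ xs → f z + c ≤ g z →
    Σ xs f + c ≤ Σ xs g
  Σ-gain (x ∷ xs) {f} {g} {c = c} le (here refl) gain = begin
    f x + Σ xs f + c    ≡⟨ solve 3 (λ a s c → a :+ s :+ c := (a :+ c) :+ s) refl (f x) (Σ xs f) c ⟩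
    (f x + c) + Σ xs f  ≤⟨ +-mono-≤ gain (Σ-mono xs le) ⟩
    g x + Σ xs g        ∎
  Σ-gain (x ∷ xs) {f} {g} {c = c} le (there z∈) gain = begin
    f x + Σ xs f + c    ≡⟨ solve 3 (λ a s c → a :+ s :+ c := a :+ (s :+ c)) refl (f x) (Σ xs f) c ⟩
    f x + (Σ xs f + c)  ≤⟨ +-mono-≤ (le x) (Σ-gain xs le z∈ gain) ⟩
    g x + Σ xs g        ∎

  Σ-<⇒∃< : ∀ (xs : List A) {f g} → Σ xs f < Σ xs g → ∃ λ x → x ∈ xs × f x < g x
  Σ-<⇒∃< [] lt = contradiction lt (<-irrefl refl)
  Σ-<⇒∃< (x ∷ xs) {f} {g} lt with f x <? g x
  ... | yes fx<gx = x , here refl , fx<gx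
  ... | no  fx≮gx with Σ xs f <? Σ xs g
  ...   | yes lt′ = map₂ (λ (x∈ , l) → there x∈ , l) (Σ-<⇒∃< xs lt′)
  ...   | no  ≮   = contradiction (<-≤-trans lt (+-mono-≤ (≮⇒≥ fx≮gx) (≮⇒≥ ≮))) (<-irrefl refl)

  -- The membership `z ∈ xs` excludes the empty list. If the first term violates the inequality, the
  -- remaining sums compare strictly and `Σ-<⇒∃<` applies.
  Σ-≤⇒∃≤ : ∀ {xs : List A} {z f g} → z ∈ xs → Σ xs f ≤ Σ xs g → ∃ λ x → x ∈ xs × f x ≤ g x
  Σ-≤⇒∃≤ {x ∷ xs} {f = f} {g} _ le with f x ≤? g x
  ... | yes fx≤gx = x , here refl , fx≤gx
  ... | no  fx≰gx with Σ xs f <? Σ xs g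
  ...   | yes lt = map₂ (λ (x∈ , l) → there x∈ , <⇒≤ l) (Σ-<⇒∃< xs lt)
  ...   | no  ≮  = contradiction (<-≤-trans (+-mono-<-≤ (≰⇒> fx≰gx) (≮⇒≥ ≮)) le) (<-irrefl refl)

  Σ-average : ∀ d (xs : List A) f → Σ xs (λ _ → average d xs f) ≡ Σ xs f
  Σ-average d []       f = refl
  Σ-average d (x ∷ xs) f = begin-equality
    Σ (x ∷ xs) (λ _ → i * s)   ≡⟨ Σ-const (x ∷ xs) (i * s) ⟩
    n * (i * s)                ≡⟨ sym (*-assoc n i s) ⟩
    (n * i) * s                ≡⟨ cong (_* s) (trans (*-comm n i) (1/n*n (length xs))) ⟩
    1ℚ * s                     ≡⟨ *-identityˡ s ⟩
    s                          ∎
    where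
    i = ℤ.+ 1 / length (x ∷ xs)
    n = nat (length (x ∷ xs))
    s = Σ (x ∷ xs) f

-- Head starts ordered by inclusion

module _ {n : ℕ} where

  _⊆_ : Vec Bool n → Vec Bool n → Set
  S ⊆ U = ∀ z → lookup S z ≡ true → lookup U z ≡ true

  ⊆-visit : ∀ S U x → S ⊆ U → (S [ x ]≔ true) ⊆ (U [ x ]≔ true)
  ⊆-visit S U x S⊆U z eq with z ≟ x
  ... | yes refl = lookup∘updateAt z U
  ... | no  z≢x  = trans (lookup∘updateAt′ z x z≢x U) (S⊆U z (trans (sym (lookup∘updateAt′ z x z≢x S)) eq))

-- Effect of a head start on the walk killed at `v`

module Comparison (G : Digraph) (conn : Connected G) (v : Digraph.Vertex G) where
  open Digraph G
  open Absorption G conn v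

  -- First-step analysis. Here `a k (S , x)` is the probability that the walk from `x` reaches `v`
  -- within `k` steps, having by then visited every other vertex outside `S`.
  recurrence : ∀ k S x → a (suc k) (S , x) ≡ b (S , x) + Σ vs (λ y → p x y * a k (S [ x ]≔ true , y))
  recurrence k S x = trans (a-step k (S , x)) (cong (b (S , x) +_) (ΣQ S x (a k)))

  recurrence-≢ : ∀ k S {x} → x ≢ v → a (suc k) (S , x) ≡ Σ vs (λ y → p x y * a k (S [ x ]≔ true , y))
  recurrence-≢ k S {x} x≢v = trans (recurrence k S x) (trans (cong (_+ s) (b-≢ S x≢v)) (+-identityˡ s))
    where s = Σ vs (λ y → p x y * a k (S [ x ]≔ true , y))

  -- The transition rates out of `v` vanish, so at `v` the head start alone decides.
  a-v : ∀ k S → a k (S , v) ≡ 𝟙 (allSeen? S)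
  a-v zero    S = b-v S
  a-v (suc k) S = begin-equality
    a (suc k) (S , v)  ≡⟨ recurrence k S v ⟩
    b (S , v) + Σ vs (λ y → p v y * a k (S [ v ]≔ true , y))
                       ≡⟨ cong (b (S , v) +_) (Σp-v (λ y → a k (S [ v ]≔ true , y))) ⟩
    b (S , v) + 0ℚ     ≡⟨ +-identityʳ (b (S , v)) ⟩
    b (S , v)          ≡⟨ b-v S ⟩
    𝟙 (allSeen? S)     ∎

  𝟙-mono : ∀ {P R : Set} (P? : Dec P) (R? : Dec R) → (P → R) → 𝟙 P? ≤ 𝟙 R?
  𝟙-mono (yes _) (yes _) _ = ≤-refl
  𝟙-mono (no _)  (no _)  _ = ≤-refl
  𝟙-mono (no _)  (yes _) _ = nonNegative⁻¹ 1ℚ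
  𝟙-mono (yes q) (no ¬r) f = contradiction (f q) ¬r

  -- At `v` a larger head start can only help, and elsewhere both sides obey the same recurrence
  -- with nonnegative coefficients.
  a-mono : ∀ k {S U} → S ⊆ U → ∀ x → a k (S , x) ≤ a k (U , x)
  a-mono k {S} {U} S⊆U x with x ≟ v
  ... | yes refl = begin
    a k (S , v)     ≡⟨ a-v k S ⟩
    𝟙 (allSeen? S)  ≤⟨ 𝟙-mono (allSeen? S) (allSeen? U) (λ seen z z≢v → S⊆U z (seen z z≢v)) ⟩
    𝟙 (allSeen? U)  ≡⟨ sym (a-v k U) ⟩
    a k (U , v)     ∎
  -- Without a step the walk has not reached `v`, so both values are 0.
  a-mono zero    {S} {U} S⊆U x | no x≢v = ≤-reflexive (trans (b-≢ S x≢v) (sym (b-≢ U x≢v)))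
  a-mono (suc k) {S} {U} S⊆U x | no x≢v = begin
    a (suc k) (S , x)                               ≡⟨ recurrence-≢ k S x≢v ⟩
    Σ vs (λ y → p x y * a k (S [ x ]≔ true , y))    ≤⟨ Σ-mono vs (λ y → *-monoˡ (p x y) (p-nonNeg x y) (a-mono k (⊆-visit S U x S⊆U) y)) ⟩
    Σ vs (λ y → p x y * a k (U [ x ]≔ true , y))    ≡⟨ sym (recurrence-≢ k U x≢v) ⟩
    a (suc k) (U , x)                               ∎

  p-pos : ∀ {x y} → x ≢ v → Edge x y → 0ℚ < p x y
  p-pos {x} {y} x≢v e = *-pos (subst (0ℚ <_) (sym (rate-≢ x≢v)) (recip-pos (out e)))
                              (subst (0ℚ <_) (sym (link-edge x y e)) (positive⁻¹ 1ℚ))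

  -- When the walk through q stops at v, it has covered everything with head start U, but it
  -- has missed u with head start S; c is the probability that the walk begins with q ∷ʳ v.
  gain : ∀ {u} → u ≢ v → ∀ q {x S U} → Linked Edge (x ∷ q ∷ʳ v) → v ∉ q → u ∉ q →
    S ⊆ U → lookup S u ≡ false → (∀ z → z ≢ v → lookup U z ≡ true ⊎ z ∈ q) →
    ∃ λ y → Edge x y × ∃ λ c → 0ℚ < c × (∀ k → length q ℕ.≤ k → a k (S , y) + c ≤ a k (U , y))
  -- The walk is already at `v`: `S` lacks `u`, while `U` must hold every vertex other than `v`, so
  -- the values are 0 and 1.
  gain {u} u≢v [] {x} {S} {U} (e ∷ _) _ _ _ u∉S covered = v , e , 1ℚ , positive⁻¹ 1ℚ , λ k _ → begin
    a k (S , v) + 1ℚ       ≡⟨ cong (_+ 1ℚ) (trans (a-v k S) (missed (allSeen? S))) ⟩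
    1ℚ                     ≡⟨ sym (trans (a-v k U) (seen (allSeen? U))) ⟩
    a k (U , v)            ∎
    where
    missed : (d : Dec (AllSeen S)) → 𝟙 d ≡ 0ℚ
    missed (no _) = refl
    missed (yes all) with trans (sym u∉S) (all u u≢v)
    ... | ()
    seen : (d : Dec (AllSeen U)) → 𝟙 d ≡ 1ℚ
    seen (yes _) = refl
    seen (no ¬all) = contradiction (λ z z≢v → visited z (covered z z≢v)) ¬all
      where
      visited : ∀ z → lookup U z ≡ true ⊎ z ∈ [] → lookup U z ≡ true
      visited z (inj₁ eq) = eq
  -- The vertex `y` moves from the walk into both head starts; `u` differs from `y` and stays
  -- missing from the smaller one.
  gain {u} u≢v (y ∷ q) {x} {S} {U} (e ∷ link) v∉ u∉ S⊆U u∉S covered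
    with gain u≢v q link (v∉ ∘ there) (u∉ ∘ there) (⊆-visit S U y S⊆U)
           (trans (lookup∘updateAt′ u y (u∉ ∘ here) S) u∉S) covered′
    where
    covered′ : ∀ z → z ≢ v → lookup (U [ y ]≔ true) z ≡ true ⊎ z ∈ q
    covered′ z z≢v with z ≟ y | covered z z≢v
    ... | yes refl | _                = inj₁ (lookup∘updateAt z U)
    ... | no z≢y   | inj₁ eq          = inj₁ (trans (lookup∘updateAt′ z y z≢y U) eq)
    ... | no z≢y   | inj₂ (here z≡y)  = contradiction z≡y z≢y
    ... | no z≢y   | inj₂ (there z∈q) = inj₂ z∈q
  ... | z , e′ , c , 0<c , later = y , e , p y z * c , *-pos (p-pos y≢v e′) 0<c , now
    where
    y≢v : y ≢ v
    y≢v = v∉ ∘ here ∘ sym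
    -- From `y` along `q` to `v` takes `suc (length q)` steps.
    now : ∀ k → suc (length q) ℕ.≤ k → a k (S , y) + p y z * c ≤ a k (U , y)
    now (suc k) (ℕ.s≤s le) = begin
      a (suc k) (S , y) + p y z * c
        ≡⟨ cong (_+ p y z * c) (recurrence-≢ k S y≢v) ⟩
      Σ vs (λ t → p y t * a k (S [ y ]≔ true , t)) + p y z * c
        -- Only the term at `z` contributes the surplus; `a-mono` handles the others.
        ≤⟨ Σ-gain vs (λ t → *-monoˡ (p y t) (p-nonNeg y t) (a-mono k (⊆-visit S U y S⊆U) t)) (∈-allFin z)
             (≤-trans (≤-reflexive (sym (*-distribˡ-+ (p y z) (a k (S [ y ]≔ true , z)) c)))
                      (*-monoˡ (p y z) (p-nonNeg y z) (later k le))) ⟩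
      Σ vs (λ t → p y t * a k (U [ y ]≔ true , t))
        ≡⟨ sym (recurrence-≢ k U y≢v) ⟩
      a (suc k) (U , y) ∎

  -- Passage to the limit and choice of the out-neighbor

  a-limit-ℙL : ∀ x → TendsTo (λ k → a k (∅ , x)) (ℙL G conn x v)
  a-limit-ℙL x = TendsTo-cong (λ k → sym (𝔼-cong k x payoff-∅)) (ℙL-limit G conn x v)

  -- The average over the first step, multiplied by the out-degree so that both sides are sums over
  -- the same list. After that step `u` counts as visited.
  first-step : ∀ k {u} → u ≢ v →
    Σ (outNeighbors u) (λ _ → a (suc k) (∅ , u)) ≡ Σ (outNeighbors u) (λ y → a k (∅ [ u ]≔ true , y))
  first-step k {u} u≢v = trans
    (Σ-cong (outNeighbors u) (λ _ → trans (recurrence-≢ k ∅ u≢v) (sym (Σp-average u≢v 0ℚ f))))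
    (Σ-average 0ℚ (outNeighbors u) f)
    where
    f : Vertex → ℚ
    f y = a k (∅ [ u ]≔ true , y)

  -- Since `c` does not depend on `k`, it survives the limit.
  Σ-ℙL : ∀ {u} → u ≢ v → ∀ c →
    (∃ λ N → ∀ k → N ℕ.≤ k →
      Σ (outNeighbors u) (λ y → a k (∅ , y)) + c ≤ Σ (outNeighbors u) (λ y → a k (∅ [ u ]≔ true , y))) →
    Σ (outNeighbors u) (λ y → ℙL G conn y v) + c ≤ Σ (outNeighbors u) (λ _ → ℙL G conn u v)
  Σ-ℙL {u} u≢v c (N , le) = TendsTo-≤
    (TendsTo-+ {λ k → Σ ys (λ y → a k (∅ , y))} {λ _ → c} {Σ ys (λ y → ℙL G conn y v)} {c}
      (TendsTo-Σ ys {λ k y → a k (∅ , y)} {λ y → ℙL G conn y v} a-limit-ℙL) (TendsTo-const c))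
    (TendsTo-Σ ys {λ k _ → a (suc k) (∅ , u)} {λ _ → ℙL G conn u v}
      -- The walk from `u` makes one step more than those from its out-neighbors; the shift keeps
      -- the limit.
      (λ _ → TendsTo-suc {λ k → a k (∅ , u)} {ℙL G conn u v} (a-limit-ℙL u)))
    (N , λ k N≤k → ≤-trans (le k N≤k) (≤-reflexive (sym (first-step k u≢v))))
    where ys = outNeighbors u

  ∅⊆ : ∀ U → ∅ ⊆ U
  ∅⊆ U z eq with trans (sym (lookup-replicate z false)) eq
  ... | ()

  edge : ∀ {u x} → x ∈ outNeighbors u → Edge u x
  edge {u} x∈ = proj₂ (∈-filter⁻ (T? ∘ adj u) {xs = vs} x∈)

  ∃ℙL≤ : ∀ {u} → u ≢ v → ∃ λ x → Edge u x × ℙL G conn x v ≤ ℙL G conn u v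
  ∃ℙL≤ {u} u≢v = map₂ (λ (x∈ , le) → edge x∈ , le)
    (Σ-≤⇒∃≤ (proj₂ (someOut u≢v)) (≤-trans (≤-reflexive (sym (+-identityʳ _))) (Σ-ℙL u≢v 0ℚ
      (0 , λ k _ → ≤-trans (≤-reflexive (+-identityʳ _)) (Σ-mono (outNeighbors u) (a-mono k (∅⊆ (∅ [ u ]≔ true))))))))

  -- The out-neighbor `y` on the given walk only makes the comparison of sums strict; the `x`
  -- obtained from it may be another one.
  ∃ℙL< : ∀ {u} → u ≢ v → (∃ λ w → WalkFromTo G u v w × VisitsAll G w × NoRevisit G u w) →
    ∃ λ x → Edge u x × ℙL G conn x v < ℙL G conn u v
  ∃ℙL< {u} u≢v (_ , (link , q , refl , v∉) , all , u∉) =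
    let y , e , c , 0<c , later = gain u≢v q link (v∉ ∘ there) (u∉ ∘ ∈-++⁺ˡ) (∅⊆ (∅ [ u ]≔ true))
                                    (lookup-replicate u false) covered
        le = Σ-ℙL u≢v c (length q , λ k len≤k →
               Σ-gain (outNeighbors u) (a-mono k (∅⊆ (∅ [ u ]≔ true))) (out e) (later k len≤k))
    in map₂ (λ (x∈ , lt) → edge x∈ , lt) (Σ-<⇒∃< (outNeighbors u) (<-≤-trans (p<p+q 0<c) le))
    where
    p<p+q : ∀ {r c} → 0ℚ < c → r < r + c
    p<p+q {r} {c} 0<c = subst (_< r + c) (+-identityʳ r) (+-monoʳ-< r 0<c)
    covered : ∀ z → z ≢ v → lookup (∅ [ u ]≔ true) z ≡ true ⊎ z ∈ q
    covered z z≢v with all z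
    ... | here refl = inj₁ (lookup∘updateAt z ∅)
    ... | there z∈ with ∈-++⁻ q z∈
    ...   | inj₁ z∈q        = inj₂ z∈q
    ...   | inj₂ (here z≡v) = contradiction z≡v z≢v

lemma1 : (G : Digraph) (conn : Connected G) → let open Digraph G in
    (u v : Vertex) → v ≢ u → ¬ Edge u v →
    (∃ λ x → Edge u x × ℙL G conn x v ≤ ℙL G conn u v)
    ×
    ((∃ λ w → WalkFromTo G u v w × VisitsAll G w × NoRevisit G u w) →
    ∃ λ x → Edge u x × ℙL G conn x v < ℙL G conn u v)
lemma1 G conn u v v≢u _ = ∃ℙL≤ (≢-sym v≢u) , ∃ℙL< (≢-sym v≢u)
  where open Comparison G conn v
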